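{- The frame properties of seriality, reflexivity, and endpointedness are not definable in $\mathcal{L}(\blacktriangle)$; that is, for each of these three properties there is no set $\Gamma\subseteq\mathcal{L}(\blacktriangle)$ such that for every frame $\mathcal{F}$, $\mathcal{F}$ has the property iff $\mathcal{F}\vDash\Gamma$.
   Context: Let $\mathbf{P}$ be a set of propositional variables. $\mathcal{L}(\blacktriangle)$-formulas: $\varphi::=\top\mid p\mid\neg\varphi\mid(\varphi\land\varphi)\mid\blacktriangle\varphi$ with $p\in\mathbf{P}$. A frame is $\mathcal{F}=\langle S,R\rangle$ with $S$ nonempty and $R\subseteq S\times S$; a model based on $\mathcal{F}$ is $\mathcal{M}=\langle S,R,V\rangle$ with $V:\mathbf{P}\to\mathcal{P}(S)$. Truth: $\top$, variables, $\neg,\land$ as usual; $\mathcal{M},s\vDash\blacktriangle\varphi$ iff (if $\mathcal{M},s\vDash\varphi$ then $\mathcal{M},t\vDash\varphi$ for all $t$ with $sRt$) and (if $\mathcal{M},s\nvDash\varphi$ then $\mathcal{M},t\nvDash\varphi$ for all $t$ with $sRt$). $\mathcal{F}\vDash\varphi$ means $\mathcal{M},s\vDash\varphi$ for every model $\mathcal{M}$ based on $\mathcal{F}$ and every $s\in S$; $\mathcal{F}\vDash\Gamma$ means $\mathcal{F}\vDash\varphi$ for all $\varphi\in\Gamma$. Serial: every $s$ has some $t$ with $sRt$. Endpointed: no world has a successor, i.e. $R=\emptyset$. -}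

module Defs where

open import Level using (Level; _⊔_) renaming (suc to lsuc)
open import Data.Product using (Σ-syntax; ∃-syntax; _×_)
open import Data.Unit.Polymorphic using (⊤)
open import Function.Bundles using (_⇔_)
open import Relation.Binary.Core using (Rel)
open import Relation.Binary.Definitions using (Reflexive; Empty)
open import Relation.Nullary using (¬_)
open import Relation.Unary using (Pred; _∈_)

infixr 6 _∧′_
infix  8 ¬′_ ▲_

data Formula {p : Level} (P : Set p) : Set p where
  ⊤′   : Formula P
  var  : P → Formula P
  ¬′_  : Formula P → Formula P
  _∧′_ : Formula P → Formula P → Formula P
  ▲_   : Formula P → Formula P

record Frame (ℓ : Level) : Set (lsuc ℓ) where
  field
    S        : Set ℓ
    R        : Rel S ℓ
    nonempty : S

record Model {p : Level} (P : Set p) (ℓ : Level) : Set (p ⊔ lsuc ℓ) where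
  constructor ⟨_,_⟩
  field
    frame : Frame ℓ
  open Frame frame public
  field
    V : P → Pred S ℓ

infix 4 _,_⊨_ _⊨ᶠ_ _⊨ᶠˢ_

_,_⊨_ : {p ℓ : Level} {P : Set p} (M : Model P ℓ) → Model.S M → Formula P → Set ℓ
M , s ⊨ ⊤′       = ⊤
M , s ⊨ var x    = s ∈ Model.V M x
M , s ⊨ ¬′ φ     = ¬ (M , s ⊨ φ)
M , s ⊨ (φ ∧′ ψ) = (M , s ⊨ φ) × (M , s ⊨ ψ)
M , s ⊨ ▲ φ      =
    (M , s ⊨ φ → ∀ t → Model.R M s t → M , t ⊨ φ)
  × (¬ (M , s ⊨ φ) → ∀ t → Model.R M s t → ¬ (M , t ⊨ φ))

_⊨ᶠ_ : {p ℓ : Level} {P : Set p} → Frame ℓ → Formula P → Set (p ⊔ lsuc ℓ)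
_⊨ᶠ_ {ℓ = ℓ} {P = P} F φ =
  (V : P → Pred (Frame.S F) ℓ) (s : Frame.S F) → ⟨ F , V ⟩ , s ⊨ φ

_⊨ᶠˢ_ : {p g ℓ : Level} {P : Set p} → Frame ℓ → Pred (Formula P) g → Set (p ⊔ g ⊔ lsuc ℓ)
F ⊨ᶠˢ Γ = ∀ φ → φ ∈ Γ → F ⊨ᶠ φ

FrameProperty : (ℓ : Level) → Set (lsuc ℓ)
FrameProperty ℓ = Pred (Frame ℓ) ℓ

SerialFrame : {ℓ : Level} → FrameProperty ℓ
SerialFrame F = ∀ s → ∃[ t ] Frame.R F s t

ReflexiveFrame : {ℓ : Level} → FrameProperty ℓ
ReflexiveFrame F = Reflexive (Frame.R F)

EndpointedFrame : {ℓ : Level} → FrameProperty ℓ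
EndpointedFrame F = Empty (Frame.R F)

-- The level g bounds the size of the predicate representing the set of formulas.
Definable : {p ℓ : Level} (P : Set p) (g : Level) → FrameProperty ℓ → Set (p ⊔ lsuc g ⊔ lsuc ℓ)
Definable {ℓ = ℓ} P g Q =
  Σ[ Γ ∈ Pred (Formula P) g ] ((F : Frame ℓ) → Q F ⇔ F ⊨ᶠˢ Γ)

{-# OPTIONS --safe #-}

-- On a one-point frame every formula ▲ φ is true, whether or not the point
-- sees itself.  Hence the irreflexive and the reflexive point validate the same
-- formulas, while only the latter is serial and reflexive and only the former
-- is endpointed.
module Submission where

open import Defs
open import Level using (Level)
open import Data.Empty.Polymorphic using (⊥; ⊥-elim)
open import Data.Product using (_×_; _,_; proj₂)
open import Data.Product.Function.NonDependent.Propositional using (_×-⇔_)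
open import Data.Unit.Polymorphic using (⊤; tt)
open import Function.Bundles using (_⇔_; mk⇔; Equivalence)
open import Function.Construct.Identity using (⇔-id)
open import Function.Related.TypeIsomorphisms using (¬-cong-⇔)
open import Relation.Nullary using (¬_)
open import Relation.Unary using (Pred)

open Equivalence using (to; from)

private
  variable
    p g ℓ : Level
    P : Set p

-- `A` is the truth value of the only possible arrow: `⊤` gives the reflexive point, `⊥` the
-- irreflexive one. Keeping it arbitrary lets one transfer argument run both ways.
point : Set ℓ → Frame ℓ
point A = record { S = ⊤ ; R = λ _ _ → A ; nonempty = tt }

-- By eta for `⊤`, any successor `t` is definitionally `tt`, so each implication returns its
-- hypothesis.
⊨▲-point : {A : Set ℓ} (V : P → Pred ⊤ ℓ) (φ : Formula P) → ⟨ point A , V ⟩ , tt ⊨ ▲ φ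
⊨▲-point V φ = (λ h _ _ → h) , (λ h _ _ → h)

-- Only the clause for `▲` consults the relation, and there both sides hold outright.
⊨-point-⇔ : {A B : Set ℓ} (V : P → Pred ⊤ ℓ) (φ : Formula P) →
            (⟨ point A , V ⟩ , tt ⊨ φ) ⇔ (⟨ point B , V ⟩ , tt ⊨ φ)
⊨-point-⇔ V ⊤′       = ⇔-id _
⊨-point-⇔ V (var x)  = ⇔-id _
⊨-point-⇔ V (¬′ φ)   = ¬-cong-⇔ (⊨-point-⇔ V φ)
⊨-point-⇔ V (φ ∧′ ψ) = ⊨-point-⇔ V φ ×-⇔ ⊨-point-⇔ V ψ
⊨-point-⇔ V (▲ φ)    = mk⇔ (λ _ → ⊨▲-point V φ) (λ _ → ⊨▲-point V φ)

⊨ᶠˢ-point : {A B : Set ℓ} (Γ : Pred (Formula P) g) → point A ⊨ᶠˢ Γ → point B ⊨ᶠˢ Γ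
-- The carriers coincide, so a valuation on `point B` is also one on `point A`.
⊨ᶠˢ-point Γ A⊨Γ φ φ∈Γ V s = to (⊨-point-⇔ V φ) (A⊨Γ φ φ∈Γ V s)

¬definable : {A B : Set ℓ} (Q : FrameProperty ℓ) →
             Q (point A) → ¬ Q (point B) → ¬ Definable P g Q
¬definable Q qA ¬qB (Γ , defines) =
  ¬qB (from (defines _) (⊨ᶠˢ-point Γ (to (defines _) qA)))

proposition18 : {p g ℓ : Level} (P : Set p) →
    (¬ Definable {ℓ = ℓ} P g SerialFrame) ×
    (¬ Definable {ℓ = ℓ} P g ReflexiveFrame) ×
    (¬ Definable {ℓ = ℓ} P g EndpointedFrame)
proposition18 P =
    ¬definable {A = ⊤} {B = ⊥} SerialFrame (λ _ → tt , tt) (λ ser → ⊥-elim (proj₂ (ser tt)))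
  , ¬definable {A = ⊤} {B = ⊥} ReflexiveFrame tt (λ rfl → ⊥-elim (rfl {tt}))
  -- The roles swap: the empty relation has the property, the loop refutes it.
  , ¬definable {A = ⊥} {B = ⊤} EndpointedFrame ⊥-elim (λ emp → emp {tt} {tt} tt)
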